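{- Let $(X,d)$ be a metric space, $p_0\in X$, $D>1$, $q\in(0,1)$, and let $n$ be a positive integer such that $qn$ is a positive integer. Let $c\ge 1$ be such that no online algorithm (without predictions) for page migration on $(X,d)$ with start position $p_0$, parameter $D$ and request sequences of length $qn$ is $c'$-competitive for any $c'<c$. Then no online algorithm with predictions for page migration on $(X,d)$ with start position $p_0$, parameter $D$ and request sequences of length $n$ is $c'$-competitive for any $c'<c$ on the class of all inputs $(\hat s,s)\in X^n\times X^n$ for which $s_t\neq\hat s_t$ for at most $qn$ indices $t\in\{1,\dots,n\}$.
   Context: Page migration problem. For a metric space $(X,d)$, parameter $D>1$ and start position $p_0\in X$, given a request sequence $s=(s_1,\dots,s_n)\in X^n$ and page positions $a=(a_1,\dots,a_n)\in X^n$, with $a_0:=p_0$, the cost of $a$ on $s$ is $\sum_{i=1}^n \left(D\, d(a_{i-1},a_i)+d(a_i,s_i)\right)$. The optimal offline cost for $s$ is the infimum of this cost over all $a\in X^n$. An online algorithm (without predictions) chooses $a_i$ depending only on $s_1,\dots,s_i$ (and the known data $X,d,p_0,D$ and the sequence length). An online algorithm with predictions additionally knows a predicted sequence $\hat s\in X^n$ in advance, while the actual sequence $s$ is revealed online, so $a_i$ depends only on $\hat s$, $s_1,\dots,s_i$ and the known data. An algorithm is $\rho$-competitive on a class of inputs if on each of them its cost on $s$ is at most $\rho$ times the optimal offline cost for $s$. -}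

module Defs where

open import Data.Fin.Base as Fin using (Fin; inject₁)
open import Data.Fin.Subset using (Subset; ∣_∣; _∈_)
open import Data.Integer.Base using (+_)
open import Data.Nat.Base as ℕ using (ℕ)
import Data.Nat.Properties as ℕₚ
open import Data.Product.Base using (Σ-syntax; ∃-syntax; _×_; _,_)
open import Data.Rational.Base as ℚ using (ℚ; 0ℚ; 1ℚ; ½)
import Data.Rational.Properties as ℚₚ
open import Data.Rational.Solver using (module +-*-Solver)
open import Data.Vec.Functional using (Vector; foldr; _∷_)
import Function.Metric.Core as Metric
import Function.Metric.Structures as Metric
open import Level using (Level; 0ℓ; suc; _⊔_)
open import Relation.Binary.Core using (Rel)
open import Relation.Binary.PropositionalEquality using (_≡_; refl; cong; sym; trans; subst)
open import Relation.Nullary.Negation using (¬_)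

private
  variable
    a ℓ i : Level

------------------------------------------------------------------------
-- Real numbers as Cauchy sequences of rationals; equality is the setoid
-- equality _≈_.

IsCauchy : (ℕ → ℚ) → Set
IsCauchy x = ∀ ε → 0ℚ ℚ.< ε → ∃[ N ] ∀ m n → N ℕ.≤ m → N ℕ.≤ n →
  ℚ.∣ x m ℚ.- x n ∣ ℚ.≤ ε

record ℝ : Set where
  constructor mkℝ
  field
    seq    : ℕ → ℚ
    cauchy : IsCauchy seq

open ℝ public

infix 4 _≈_ _≤_ _<_

_≈_ : Rel ℝ 0ℓ
x ≈ y = ∀ ε → 0ℚ ℚ.< ε → ∃[ N ] ∀ n → N ℕ.≤ n →
  ℚ.∣ seq x n ℚ.- seq y n ∣ ℚ.≤ ε

_≤_ : Rel ℝ 0ℓ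
x ≤ y = ∀ ε → 0ℚ ℚ.< ε → ∃[ N ] ∀ n → N ℕ.≤ n →
  seq x n ℚ.≤ seq y n ℚ.+ ε

-- A uniform positive rational gap is required: pointwise strict
-- inequality of the sequences would not give strict inequality of limits.
_<_ : Rel ℝ 0ℓ
x < y = ∃[ ε ] 0ℚ ℚ.< ε × ∃[ N ] ∀ n → N ℕ.≤ n →
  seq x n ℚ.+ ε ℚ.≤ seq y n

private
  open +-*-Solver using (solve; _:=_; _:+_; _:*_; _:-_; con)

  -- Opaque for typechecking speed: equality and order on ℝ ignore these proofs.
  opaque
    const-isCauchy : ∀ p → IsCauchy (λ _ → p)
    const-isCauchy p ε 0<ε = 0 , λ _ _ _ _ →
      subst (ℚ._≤ ε) (sym (cong ℚ.∣_∣ (ℚₚ.+-inverseʳ p))) (ℚₚ.<⇒≤ 0<ε)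

    +-regroup : ∀ p q r s → (p ℚ.+ q) ℚ.- (r ℚ.+ s) ≡ (p ℚ.- r) ℚ.+ (q ℚ.- s)
    +-regroup = solve 4 (λ p q r s → (p :+ q) :- (r :+ s) := (p :- r) :+ (q :- s)) refl

    *-regroup : ∀ p q r s → p ℚ.* q ℚ.- r ℚ.* s ≡ p ℚ.* (q ℚ.- s) ℚ.+ s ℚ.* (p ℚ.- r)
    *-regroup = solve 4 (λ p q r s → p :* q :- r :* s := p :* (q :- s) :+ s :* (p :- r)) refl

    halves : ∀ p → ½ ℚ.* p ℚ.+ ½ ℚ.* p ≡ p
    halves = solve 1 (λ p → con ½ :* p :+ con ½ :* p := p) refl

    add-difference : ∀ p q → p ≡ q ℚ.+ (p ℚ.- q)
    add-difference = solve 2 (λ p q → p := q :+ (p :- q)) refl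

    0<½*ε : ∀ {ε} → 0ℚ ℚ.< ε → 0ℚ ℚ.< ½ ℚ.* ε
    0<½*ε {ε} 0<ε =
      subst (ℚ._< ½ ℚ.* ε) (ℚₚ.*-zeroʳ ½) (ℚₚ.*-monoʳ-<-pos ½ 0<ε)

    +-isCauchy : ∀ x y → IsCauchy x → IsCauchy y → IsCauchy (λ n → x n ℚ.+ y n)
    +-isCauchy x y cx cy ε 0<ε
      with cx (½ ℚ.* ε) (0<½*ε 0<ε) | cy (½ ℚ.* ε) (0<½*ε 0<ε)
    ... | M , px | N , py = M ℕ.⊔ N , λ m n m≥ n≥ → begin
      ℚ.∣ (x m ℚ.+ y m) ℚ.- (x n ℚ.+ y n) ∣
        ≡⟨ cong ℚ.∣_∣ (+-regroup (x m) (y m) (x n) (y n)) ⟩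
      ℚ.∣ (x m ℚ.- x n) ℚ.+ (y m ℚ.- y n) ∣
        ≤⟨ ℚₚ.∣p+q∣≤∣p∣+∣q∣ (x m ℚ.- x n) (y m ℚ.- y n) ⟩
      ℚ.∣ x m ℚ.- x n ∣ ℚ.+ ℚ.∣ y m ℚ.- y n ∣
        ≤⟨ ℚₚ.+-mono-≤
             (px m n (ℕₚ.m⊔n≤o⇒m≤o M N m≥) (ℕₚ.m⊔n≤o⇒m≤o M N n≥))
             (py m n (ℕₚ.m⊔n≤o⇒n≤o M N m≥) (ℕₚ.m⊔n≤o⇒n≤o M N n≥)) ⟩
      ½ ℚ.* ε ℚ.+ ½ ℚ.* ε
        ≡⟨ halves ε ⟩
      ε ∎
      where open ℚₚ.≤-Reasoning

    eventuallyBounded : ∀ x → IsCauchy x →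
      ∃[ B ] 0ℚ ℚ.< B × ∃[ N ] ∀ n → N ℕ.≤ n → ℚ.∣ x n ∣ ℚ.≤ B
    eventuallyBounded x cx with cx 1ℚ (ℚₚ.positive⁻¹ 1ℚ)
    ... | N , p = ℚ.∣ x N ∣ ℚ.+ 1ℚ
      , ℚₚ.+-mono-≤-< (ℚₚ.0≤∣p∣ (x N)) (ℚₚ.positive⁻¹ 1ℚ)
      , N , λ n n≥ → begin
        ℚ.∣ x n ∣
          ≡⟨ cong ℚ.∣_∣ (add-difference (x n) (x N)) ⟩
        ℚ.∣ x N ℚ.+ (x n ℚ.- x N) ∣
          ≤⟨ ℚₚ.∣p+q∣≤∣p∣+∣q∣ (x N) (x n ℚ.- x N) ⟩
        ℚ.∣ x N ∣ ℚ.+ ℚ.∣ x n ℚ.- x N ∣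
          ≤⟨ ℚₚ.+-monoʳ-≤ ℚ.∣ x N ∣ (p n N n≥ ℕₚ.≤-refl) ⟩
        ℚ.∣ x N ∣ ℚ.+ 1ℚ ∎
      where open ℚₚ.≤-Reasoning

    ∣*∣-mono : ∀ p q {b e} → 0ℚ ℚ.< b → ℚ.∣ p ∣ ℚ.≤ b → ℚ.∣ q ∣ ℚ.≤ e →
      ℚ.∣ p ℚ.* q ∣ ℚ.≤ b ℚ.* e
    ∣*∣-mono p q {b} {e} 0<b p≤b q≤e = begin
      ℚ.∣ p ℚ.* q ∣         ≡⟨ ℚₚ.∣p*q∣≡∣p∣*∣q∣ p q ⟩
      ℚ.∣ p ∣ ℚ.* ℚ.∣ q ∣   ≤⟨ ℚₚ.*-monoʳ-≤-nonNeg ℚ.∣ q ∣ {{ℚₚ.∣-∣-nonNeg q}} p≤b ⟩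
      b ℚ.* ℚ.∣ q ∣         ≤⟨ ℚₚ.*-monoˡ-≤-nonNeg b {{ℚ.nonNegative (ℚₚ.<⇒≤ 0<b)}} q≤e ⟩
      b ℚ.* e               ∎
      where open ℚₚ.≤-Reasoning

    quotient : ∀ b ε → 0ℚ ℚ.< b → 0ℚ ℚ.< ε → ∃[ δ ] 0ℚ ℚ.< δ × b ℚ.* δ ≡ ε
    quotient b ε 0<b 0<ε = 1/b ℚ.* ε
      , subst (ℚ._< 1/b ℚ.* ε) (ℚₚ.*-zeroʳ 1/b) (ℚₚ.*-monoʳ-<-pos 1/b {{ℚₚ.1/pos⇒pos b}} 0<ε)
      , trans (sym (ℚₚ.*-assoc b 1/b ε))
          (trans (cong (ℚ._* ε) (ℚₚ.*-inverseʳ b)) (ℚₚ.*-identityˡ ε))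
      where
      instance
        b-positive : ℚ.Positive b
        b-positive = ℚ.positive 0<b
        b-nonZero : ℚ.NonZero b
        b-nonZero = ℚₚ.pos⇒nonZero b
      1/b : ℚ
      1/b = ℚ.1/ b

    ∣*-*∣-bound : ∀ p q r s {b c e} → 0ℚ ℚ.< b → 0ℚ ℚ.< c →
      ℚ.∣ p ∣ ℚ.≤ b → ℚ.∣ s ∣ ℚ.≤ c →
      ℚ.∣ p ℚ.- r ∣ ℚ.≤ e → ℚ.∣ q ℚ.- s ∣ ℚ.≤ e →
      ℚ.∣ p ℚ.* q ℚ.- r ℚ.* s ∣ ℚ.≤ (b ℚ.+ c) ℚ.* e
    ∣*-*∣-bound p q r s {b} {c} {e} 0<b 0<c p≤b s≤c p-r≤e q-s≤e = begin
      ℚ.∣ p ℚ.* q ℚ.- r ℚ.* s ∣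
        ≡⟨ cong ℚ.∣_∣ (*-regroup p q r s) ⟩
      ℚ.∣ p ℚ.* (q ℚ.- s) ℚ.+ s ℚ.* (p ℚ.- r) ∣
        ≤⟨ ℚₚ.∣p+q∣≤∣p∣+∣q∣ (p ℚ.* (q ℚ.- s)) (s ℚ.* (p ℚ.- r)) ⟩
      ℚ.∣ p ℚ.* (q ℚ.- s) ∣ ℚ.+ ℚ.∣ s ℚ.* (p ℚ.- r) ∣
        ≤⟨ ℚₚ.+-mono-≤ (∣*∣-mono p (q ℚ.- s) 0<b p≤b q-s≤e)
                       (∣*∣-mono s (p ℚ.- r) 0<c s≤c p-r≤e) ⟩
      b ℚ.* e ℚ.+ c ℚ.* e
        ≡⟨ sym (ℚₚ.*-distribʳ-+ e b c) ⟩
      (b ℚ.+ c) ℚ.* e ∎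
      where open ℚₚ.≤-Reasoning

    *-isCauchy : ∀ x y → IsCauchy x → IsCauchy y → IsCauchy (λ n → x n ℚ.* y n)
    *-isCauchy x y cx cy ε 0<ε =
      let A , 0<A , K , x≤A = eventuallyBounded x cx
          B , 0<B , L , y≤B = eventuallyBounded y cy
          δ , 0<δ , eq      = quotient (A ℚ.+ B) ε (ℚₚ.+-mono-< 0<A 0<B) 0<ε
          M , px            = cx δ 0<δ
          N , py            = cy δ 0<δ
      in (K ℕ.⊔ L) ℕ.⊔ (M ℕ.⊔ N) , λ m n m≥ n≥ →
        let KL≤m = ℕₚ.m⊔n≤o⇒m≤o (K ℕ.⊔ L) (M ℕ.⊔ N) m≥
            KL≤n = ℕₚ.m⊔n≤o⇒m≤o (K ℕ.⊔ L) (M ℕ.⊔ N) n≥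
            MN≤m = ℕₚ.m⊔n≤o⇒n≤o (K ℕ.⊔ L) (M ℕ.⊔ N) m≥
            MN≤n = ℕₚ.m⊔n≤o⇒n≤o (K ℕ.⊔ L) (M ℕ.⊔ N) n≥
        in subst (ℚ.∣ x m ℚ.* y m ℚ.- x n ℚ.* y n ∣ ℚ.≤_) eq
          (∣*-*∣-bound (x m) (y m) (x n) (y n) 0<A 0<B
            (x≤A m (ℕₚ.m⊔n≤o⇒m≤o K L KL≤m))
            (y≤B n (ℕₚ.m⊔n≤o⇒n≤o K L KL≤n))
            (px m n (ℕₚ.m⊔n≤o⇒m≤o M N MN≤m) (ℕₚ.m⊔n≤o⇒m≤o M N MN≤n))
            (py m n (ℕₚ.m⊔n≤o⇒n≤o M N MN≤m) (ℕₚ.m⊔n≤o⇒n≤o M N MN≤n)))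

fromℚ : ℚ → ℝ
fromℚ p = mkℝ (λ _ → p) (const-isCauchy p)

fromℕ : ℕ → ℝ
fromℕ n = fromℚ (+ n ℚ./ 1)

0ℝ 1ℝ : ℝ
0ℝ = fromℚ 0ℚ
1ℝ = fromℚ 1ℚ

infixl 7 _*_
infixl 6 _+_

_+_ : ℝ → ℝ → ℝ
x + y = mkℝ (λ n → seq x n ℚ.+ seq y n) (+-isCauchy (seq x) (seq y) (cauchy x) (cauchy y))

_*_ : ℝ → ℝ → ℝ
x * y = mkℝ (λ n → seq x n ℚ.* seq y n) (*-isCauchy (seq x) (seq y) (cauchy x) (cauchy y))

∑ : ∀ {n} → Vector ℝ n → ℝ
∑ = foldr _+_ 0ℝ

IsInfimum : {I : Set i} → (I → ℝ) → ℝ → Set i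
IsInfimum f x = (∀ j → x ≤ f j) × (∀ l → (∀ j → l ≤ f j) → l ≤ x)

record MetricSpace a ℓ : Set (suc (a ⊔ ℓ)) where
  field
    Carrier  : Set a
    _≈ₓ_     : Rel Carrier ℓ
    d        : Metric.DistanceFunction Carrier ℝ
    isMetric : Metric.IsGeneralMetric _≈ₓ_ _≈_ _≤_ 0ℝ _+_ d

  infix 4 _≈ₓ_

  open Metric.IsGeneralMetric isMetric public

------------------------------------------------------------------------
-- Page migration

module PageMigration (X : MetricSpace a ℓ) (D : ℝ) (p₀ : MetricSpace.Carrier X) where

  open MetricSpace X using (Carrier; _≈ₓ_; d)

  -- The entry of p₀ ∷ p at position inject₁ t is the page position just
  -- before request t is served.
  cost : ∀ {n} → Vector Carrier n → Vector Carrier n → ℝ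
  cost p s = ∑ λ t → D * d ((p₀ ∷ p) (inject₁ t)) (p t) + d (p t) (s t)

  IsOptimalCost : ∀ {n} → Vector Carrier n → ℝ → Set a
  IsOptimalCost s = IsInfimum (λ p → cost p s)

  -- "Depends only on" is rendered as invariance under changing the other
  -- data, with points compared by the equality of the metric space.
  record OnlineAlgorithm (n : ℕ) : Set (a ⊔ ℓ) where
    field
      run    : Vector Carrier n → Vector Carrier n
      online : ∀ s s′ t → (∀ u → u Fin.≤ t → s u ≈ₓ s′ u) → run s t ≈ₓ run s′ t

  record PredictionAlgorithm (n : ℕ) : Set (a ⊔ ℓ) where
    field
      run    : (ŝ s : Vector Carrier n) → Vector Carrier n
      online : ∀ ŝ ŝ′ s s′ t → (∀ u → ŝ u ≈ₓ ŝ′ u) →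
               (∀ u → u Fin.≤ t → s u ≈ₓ s′ u) → run ŝ s t ≈ₓ run ŝ′ s′ t

  -- Costs are bounded below by 0, so classically every s has exactly one
  -- optimal cost (up to _≈_); quantifying over all of them avoids asserting
  -- its existence constructively.
  Competitive : ∀ {n} → ℝ → OnlineAlgorithm n → Set a
  Competitive ρ A = ∀ s opt → IsOptimalCost s opt → cost (run s) s ≤ ρ * opt
    where open OnlineAlgorithm A

  CompetitiveOn : ∀ {n c} → (Vector Carrier n → Vector Carrier n → Set c) →
                  ℝ → PredictionAlgorithm n → Set (a ⊔ c)
  CompetitiveOn Class ρ A = ∀ ŝ s → Class ŝ s → ∀ opt → IsOptimalCost s opt →
                            cost (run ŝ s) s ≤ ρ * opt
    where open PredictionAlgorithm A

  -- Equality of points need not be decidable, so the set of mispredicted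
  -- indices is bounded by a decidable set containing it.
  ErrorsAtMost : ∀ {n} → ℕ → Vector Carrier n → Vector Carrier n → Set ℓ
  ErrorsAtMost {n} k ŝ s =
    Σ[ E ∈ Subset n ] ∣ E ∣ ℕ.≤ k × (∀ t → ¬ (s t ≈ₓ ŝ t) → t ∈ E)

{-# OPTIONS --safe #-}

-- Pad a short request sequence s in front with n − qn requests at p₀, and
-- predict that all n requests are at p₀: at most the last qn predictions
-- are wrong. Serving the padding from p₀ is free and, by the triangle
-- inequality, wandering off during the padding cannot help, so the padded
-- sequence has the same optimal cost as s. Hence the last qn positions of a
-- prediction algorithm run on the padded sequence form an online algorithm
-- that is no less competitive.

module Submission where

open import Data.Fin.Base as Fin using (Fin; zero; suc; inject₁; _↑ʳ_)
open import Data.Fin.Subset using (Subset; ∣_∣; _∈_; outside; ⊤)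
open import Data.Fin.Subset.Properties using (∣⊤∣≡n; ∈⊤)
open import Data.Integer.Base as ℤ using (+_)
import Data.Integer.Properties as ℤₚ
open import Data.Nat.Base as ℕ using (ℕ; s≤s; s≤s⁻¹)
import Data.Nat.Properties as ℕₚ
open import Data.Product.Base using (∃-syntax; _×_; _,_; proj₁; proj₂)
open import Data.Rational.Base as ℚ using (ℚ; 0ℚ; 1ℚ; ½; toℚᵘ)
import Data.Rational.Properties as ℚₚ
open import Data.Rational.Solver using (module +-*-Solver)
open import Data.Rational.Unnormalised.Base as ℚᵘ using (mkℚᵘ)
import Data.Rational.Unnormalised.Properties as ℚᵘₚ
open import Data.Vec.Base as Vec using (there)
open import Data.Vec.Functional using (Vector; _∷_; tail; drop; replicate)
open import Level using (0ℓ)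
open import Relation.Binary.Core using (Rel)
open import Relation.Binary.Bundles using (Poset)
import Relation.Binary.Reasoning.PartialOrder as ≤-Reasoning
open import Data.Sum.Base using (inj₁; inj₂)
open import Relation.Binary.PropositionalEquality using (_≡_; refl; sym; cong; subst;
  module ≡-Reasoning)
open import Relation.Nullary.Negation using (¬_; contradiction)
open import Defs

-- Order and arithmetic of ℝ

open +-*-Solver using (solve; _:=_; _:+_; _:*_; _:-_; con)

opaque
  +-interchange-halves : ∀ p q ε → (p ℚ.+ ½ ℚ.* ε) ℚ.+ (q ℚ.+ ½ ℚ.* ε) ≡ (p ℚ.+ q) ℚ.+ ε
  +-interchange-halves = solve 3
    (λ p q ε → (p :+ con ½ :* ε) :+ (q :+ con ½ :* ε) := (p :+ q) :+ ε) refl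

  q+[p-q]≡p : ∀ p q → q ℚ.+ (p ℚ.- q) ≡ p
  q+[p-q]≡p = solve 2 (λ p q → q :+ (p :- q) := p) refl

  p*0+0+q≡q : ∀ p q → (p ℚ.* 0ℚ ℚ.+ 0ℚ) ℚ.+ q ≡ q
  p*0+0+q≡q = solve 2 (λ p q → (p :* con 0ℚ :+ con 0ℚ) :+ q := q) refl

  first-step-regroup : ∀ u w v b r →
    (((u ℚ.+ v) ℚ.+ b) ℚ.+ r) ℚ.+ w ≡ (u ℚ.+ w) ℚ.+ ((v ℚ.+ b) ℚ.+ r)
  first-step-regroup = solve 5 (λ u w v b r →
    (((u :+ v) :+ b) :+ r) :+ w := (u :+ w) :+ ((v :+ b) :+ r)) refl

p≤∣p∣ : ∀ p → p ℚ.≤ ℚ.∣ p ∣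
p≤∣p∣ p with ℚₚ.≤-total 0ℚ p
... | inj₁ 0≤p = ℚₚ.≤-reflexive (sym (ℚₚ.0≤p⇒∣p∣≡p 0≤p))
... | inj₂ p≤0 = ℚₚ.≤-trans p≤0 (ℚₚ.0≤∣p∣ p)

p*1/p*q≡q : ∀ p q .{{_ : ℚ.NonZero p}} → p ℚ.* (ℚ.1/ p ℚ.* q) ≡ q
p*1/p*q≡q p q = begin
  p ℚ.* (ℚ.1/ p ℚ.* q)  ≡⟨ ℚₚ.*-assoc p (ℚ.1/ p) q ⟨
  p ℚ.* ℚ.1/ p ℚ.* q    ≡⟨ cong (ℚ._* q) (ℚₚ.*-inverseʳ p) ⟩
  1ℚ ℚ.* q              ≡⟨ ℚₚ.*-identityˡ q ⟩
  q                     ∎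
  where open ≡-Reasoning

-- Clearing denominators gives `2m ≤ 2n + 1`, that is `2m < 2(n + 1)`, and 2 cancels. The detour
-- through unnormalised rationals exposes the numerators, which normalisation by a gcd would hide.
m/1≤n/1+½⇒m≤n : ∀ m n → + m ℚ./ 1 ℚ.≤ + n ℚ./ 1 ℚ.+ ½ → m ℕ.≤ n
m/1≤n/1+½⇒m≤n m n m≤n+½ =
  s≤s⁻¹ (ℕₚ.*-cancelʳ-< 2 m (ℕ.suc n) (s≤s (ℤₚ.drop‿+≤+ 2m≤2n+1)))
  where
  m≤n+½ᵘ : mkℚᵘ (+ m) 0 ℚᵘ.≤ mkℚᵘ (+ n) 0 ℚᵘ.+ toℚᵘ ½
  m≤n+½ᵘ = begin
    mkℚᵘ (+ m) 0                     ≃⟨ ℚₚ.toℚᵘ-fromℚᵘ (mkℚᵘ (+ m) 0) ⟨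
    toℚᵘ (+ m ℚ./ 1)                 ≤⟨ ℚₚ.toℚᵘ-mono-≤ m≤n+½ ⟩
    toℚᵘ (+ n ℚ./ 1 ℚ.+ ½)           ≃⟨ ℚₚ.toℚᵘ-homo-+ (+ n ℚ./ 1) ½ ⟩
    toℚᵘ (+ n ℚ./ 1) ℚᵘ.+ toℚᵘ ½
      ≃⟨ ℚᵘₚ.+-congˡ (toℚᵘ ½) (ℚₚ.toℚᵘ-fromℚᵘ (mkℚᵘ (+ n) 0)) ⟩
    mkℚᵘ (+ n) 0 ℚᵘ.+ toℚᵘ ½         ∎
    where open ℚᵘₚ.≤-Reasoning

  2m≤2n+1 : + (m ℕ.* 2) ℤ.≤ + (ℕ.suc (n ℕ.* 2))
  2m≤2n+1 = begin
    + (m ℕ.* 2)                         ≡⟨ ℤₚ.pos-* m 2 ⟩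
    + m ℤ.* + 2                         ≤⟨ ℚᵘₚ.drop-*≤* m≤n+½ᵘ ⟩
    (+ n ℤ.* + 2 ℤ.+ + 1) ℤ.* + 1       ≡⟨ ℤₚ.*-identityʳ _ ⟩
    + n ℤ.* + 2 ℤ.+ + 1                 ≡⟨ cong (ℤ._+ + 1) (ℤₚ.pos-* n 2) ⟨
    + (n ℕ.* 2 ℕ.+ 1)                   ≡⟨ cong +_ (ℕₚ.+-comm (n ℕ.* 2) 1) ⟩
    + (ℕ.suc (n ℕ.* 2))                 ∎
    where open ℤₚ.≤-Reasoning

eventually-≤⇒≤ : ∀ x y → ∃[ N ] (∀ n → N ℕ.≤ n → seq x n ℚ.≤ seq y n) → x ≤ y
eventually-≤⇒≤ x y (N , x≤y) ε 0<ε = N , λ n N≤n → begin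
  seq x n         ≤⟨ x≤y n N≤n ⟩
  seq y n         ≡⟨ ℚₚ.+-identityʳ (seq y n) ⟨
  seq y n ℚ.+ 0ℚ  ≤⟨ ℚₚ.+-monoʳ-≤ (seq y n) (ℚₚ.<⇒≤ 0<ε) ⟩
  seq y n ℚ.+ ε   ∎
  where open ℚₚ.≤-Reasoning

-- Operations on `ℝ` act termwise, so this carries ring identities of `ℚ` into chains of
-- inequalities in `ℝ`.
pointwise-≡⇒≤ : ∀ x y → (∀ n → seq x n ≡ seq y n) → x ≤ y
pointwise-≡⇒≤ x y x≡y = eventually-≤⇒≤ x y (0 , λ n _ → ℚₚ.≤-reflexive (x≡y n))

≤-refl : ∀ x → x ≤ x
≤-refl x = pointwise-≡⇒≤ x x (λ _ → refl)

<-eventually : ∀ x y → x < y → ∃[ N ] (∀ n → N ℕ.≤ n → seq x n ℚ.≤ seq y n)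
<-eventually x y (ε , 0<ε , N , x+ε≤y) = N , λ n N≤n → begin
  seq x n         ≡⟨ ℚₚ.+-identityʳ (seq x n) ⟨
  seq x n ℚ.+ 0ℚ  ≤⟨ ℚₚ.+-monoʳ-≤ (seq x n) (ℚₚ.<⇒≤ 0<ε) ⟩
  seq x n ℚ.+ ε   ≤⟨ x+ε≤y n N≤n ⟩
  seq y n         ∎
  where open ℚₚ.≤-Reasoning

+-mono-≤ : ∀ x y z w → x ≤ y → z ≤ w → x + z ≤ y + w
+-mono-≤ x y z w x≤y z≤w ε 0<ε =
  let 0<ε/2 = subst (ℚ._< ½ ℚ.* ε) (ℚₚ.*-zeroʳ ½) (ℚₚ.*-monoʳ-<-pos ½ 0<ε)
      M , p = x≤y (½ ℚ.* ε) 0<ε/2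
      N , q = z≤w (½ ℚ.* ε) 0<ε/2
  in M ℕ.⊔ N , λ n n≥ →
     subst (seq x n ℚ.+ seq z n ℚ.≤_) (+-interchange-halves (seq y n) (seq w n) ε)
       (ℚₚ.+-mono-≤ (p n (ℕₚ.m⊔n≤o⇒m≤o M N n≥)) (q n (ℕₚ.m⊔n≤o⇒n≤o M N n≥)))

eventually-bounded : ∀ x → ∃[ b ] 0ℚ ℚ.< b × ∃[ N ] (∀ n → N ℕ.≤ n → seq x n ℚ.≤ b)
eventually-bounded x with cauchy x 1ℚ (ℚₚ.positive⁻¹ 1ℚ)
... | N , close = ℚ.∣ seq x N ∣ ℚ.+ 1ℚ
  , ℚₚ.+-mono-≤-< (ℚₚ.0≤∣p∣ (seq x N)) (ℚₚ.positive⁻¹ 1ℚ)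
  , N , λ n N≤n → begin
    seq x n                            ≡⟨ q+[p-q]≡p (seq x n) (seq x N) ⟨
    seq x N ℚ.+ (seq x n ℚ.- seq x N)
      ≤⟨ ℚₚ.+-mono-≤ (p≤∣p∣ (seq x N))
           (ℚₚ.≤-trans (p≤∣p∣ (seq x n ℚ.- seq x N)) (close n N N≤n ℕₚ.≤-refl)) ⟩
    ℚ.∣ seq x N ∣ ℚ.+ 1ℚ               ∎
  where open ℚₚ.≤-Reasoning

-- Multiplication by `z` scales the slack in `x ≤ y` by terms that eventually lie between 0 and `b`,
-- so slack `ε / b` there yields `ε` here. Strict positivity makes these terms eventually
-- nonnegative, which `0ℝ ≤ z` would not.
*-monoˡ-≤-pos : ∀ z x y → 0ℝ < z → x ≤ y → z * x ≤ z * y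
*-monoˡ-≤-pos z x y 0<z x≤y ε 0<ε
  with <-eventually 0ℝ z 0<z | eventually-bounded z
... | K , 0≤z | b , 0<b , L , z≤b = K ℕ.⊔ L ℕ.⊔ proj₁ x≤y+δ , λ n n≥ →
  let KL≤n = ℕₚ.m⊔n≤o⇒m≤o (K ℕ.⊔ L) (proj₁ x≤y+δ) n≥
      instance z-nonNeg = ℚ.nonNegative (0≤z n (ℕₚ.m⊔n≤o⇒m≤o K L KL≤n))
  in begin
    seq z n ℚ.* seq x n
      ≤⟨ ℚₚ.*-monoˡ-≤-nonNeg (seq z n) (proj₂ x≤y+δ n (ℕₚ.m⊔n≤o⇒n≤o (K ℕ.⊔ L) _ n≥)) ⟩
    seq z n ℚ.* (seq y n ℚ.+ δ)
      ≡⟨ ℚₚ.*-distribˡ-+ (seq z n) (seq y n) δ ⟩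
    seq z n ℚ.* seq y n ℚ.+ seq z n ℚ.* δ
      ≤⟨ ℚₚ.+-monoʳ-≤ (seq z n ℚ.* seq y n)
           (ℚₚ.*-monoʳ-≤-nonNeg δ {{ℚ.nonNegative (ℚₚ.<⇒≤ 0<δ)}} (z≤b n (ℕₚ.m⊔n≤o⇒n≤o K L KL≤n))) ⟩
    seq z n ℚ.* seq y n ℚ.+ b ℚ.* δ
      ≡⟨ cong (seq z n ℚ.* seq y n ℚ.+_) (p*1/p*q≡q b ε) ⟩
    seq z n ℚ.* seq y n ℚ.+ ε ∎
  where
  open ℚₚ.≤-Reasoning
  instance
    b-positive : ℚ.Positive b
    b-positive = ℚ.positive 0<b
    b-nonZero : ℚ.NonZero b
    b-nonZero = ℚₚ.pos⇒nonZero b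
  δ : ℚ
  δ = ℚ.1/ b ℚ.* ε
  0<δ : 0ℚ ℚ.< δ
  0<δ = subst (ℚ._< δ) (ℚₚ.*-zeroʳ (ℚ.1/ b))
          (ℚₚ.*-monoʳ-<-pos (ℚ.1/ b) {{ℚₚ.1/pos⇒pos b}} 0<ε)
  x≤y+δ = x≤y δ 0<δ

-- Distinct naturals differ by at least 1, so a single term of each sequence, compared with slack ½,
-- decides.
fromℕ-cancel-≤ : ∀ m n → fromℕ m ≤ fromℕ n → m ℕ.≤ n
fromℕ-cancel-≤ m n m≤n with m≤n ½ (ℚₚ.positive⁻¹ ½)
... | N , p = m/1≤n/1+½⇒m≤n m n (p N ℕₚ.≤-refl)

q<1⇒q*n≤n : ∀ q n → q < 1ℝ → q * fromℕ n ≤ fromℕ n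
q<1⇒q*n≤n q n q<1 with <-eventually q 1ℝ q<1
... | N , q≤1 = eventually-≤⇒≤ (q * fromℕ n) (fromℕ n) (N , λ k N≤k →
  subst (seq q k ℚ.* (+ n ℚ./ 1) ℚ.≤_) (ℚₚ.*-identityˡ (+ n ℚ./ 1))
    (ℚₚ.*-monoʳ-≤-nonNeg (+ n ℚ./ 1) {{ℚₚ.normalize-nonNeg n 1}} (q≤1 k N≤k)))

1<x⇒0<x : ∀ x → 1ℝ < x → 0ℝ < x
1<x⇒0<x x (ε , 0<ε , N , 1+ε≤x) = ε , 0<ε , N , λ n N≤n →
  ℚₚ.≤-trans (ℚₚ.+-monoˡ-≤ ε (ℚₚ.<⇒≤ (ℚₚ.positive⁻¹ 1ℚ))) (1+ε≤x n N≤n)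

-- Padding

module _ {a} {A : Set a} where

  -- Recursion on `k` makes each padding step a cons by computation, so facts about one prepended
  -- request iterate directly.
  pad : ∀ k {n} → A → Vector A n → Vector A (k ℕ.+ n)
  pad ℕ.zero    x s = s
  pad (ℕ.suc k) x s = x ∷ pad k x s

  -- Needed to transfer the online condition: what precedes position `k ↑ʳ t` of the padded sequence
  -- is fixed padding followed by requests up to `t`.
  pad-cong-≤ : ∀ {ℓ} (_≈_ : Rel A ℓ) k {x} → x ≈ x → ∀ {n} (s s′ : Vector A n) (t : Fin n) →
    (∀ u → u Fin.≤ t → s u ≈ s′ u) → ∀ u → u Fin.≤ (k ↑ʳ t) → pad k x s u ≈ pad k x s′ u
  pad-cong-≤ _≈_ ℕ.zero    x≈x s s′ t s≈s′ u       u≤t = s≈s′ u u≤t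
  pad-cong-≤ _≈_ (ℕ.suc k) x≈x s s′ t s≈s′ zero    u≤t = x≈x
  pad-cong-≤ _≈_ (ℕ.suc k) x≈x s s′ t s≈s′ (suc u) u≤t =
    pad-cong-≤ _≈_ k x≈x s s′ t s≈s′ u (s≤s⁻¹ u≤t)

-- Explicit witness for `ErrorsAtMost`, chosen without testing points for equality.
lastIndices : ∀ k n → Subset (k ℕ.+ n)
lastIndices ℕ.zero    n = ⊤
lastIndices (ℕ.suc k) n = outside Vec.∷ lastIndices k n

∣lastIndices∣≡n : ∀ k n → ∣ lastIndices k n ∣ ≡ n
∣lastIndices∣≡n ℕ.zero    n = ∣⊤∣≡n n
∣lastIndices∣≡n (ℕ.suc k) n = ∣lastIndices∣≡n k n

-- Page migration with requests prepended at the start position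

module _ {a ℓ} (X : MetricSpace a ℓ) where

  open MetricSpace X using (isPartialOrder; module EqI) renaming (reflexive to ≈⇒≤)

  -- That _≤_ is a partial order on ℝ comes packaged with any metric space,
  -- which is why even q*n≈m⇒m≤n below takes X.
  private
    ℝ-poset : Poset 0ℓ 0ℓ 0ℓ
    ℝ-poset = record { isPartialOrder = isPartialOrder }

  open ≤-Reasoning ℝ-poset

  q*n≈m⇒m≤n : ∀ q n m → q < 1ℝ → q * fromℕ n ≈ fromℕ m → m ℕ.≤ n
  q*n≈m⇒m≤n q n m q<1 q*n≈m = fromℕ-cancel-≤ m n (begin
    fromℕ m      ≈⟨ q*n≈m ⟨
    q * fromℕ n  ≤⟨ q<1⇒q*n≤n q n q<1 ⟩
    fromℕ n      ∎)

  module _ (p₀ : MetricSpace.Carrier X) (D : ℝ) (0<D : 0ℝ < D) where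

    open MetricSpace X using (Carrier; _≈ₓ_; d; nonNegative; triangle; ≈⇒0; module EqC)
    open PageMigration X D p₀

    0≤D*d : ∀ x y → 0ℝ ≤ D * d x y
    0≤D*d x y = begin
      0ℝ         ≤⟨ pointwise-≡⇒≤ 0ℝ (D * 0ℝ) (λ n → sym (ℚₚ.*-zeroʳ (seq D n))) ⟩
      D * 0ℝ     ≤⟨ *-monoˡ-≤-pos D 0ℝ (d x y) 0<D nonNegative ⟩
      D * d x y  ∎

    D*d-triangle : ∀ x y z → D * d x z ≤ D * d x y + D * d y z
    D*d-triangle x y z = begin
      D * d x z
        ≤⟨ *-monoˡ-≤-pos D (d x z) (d x y + d y z) 0<D (triangle x y z) ⟩
      D * (d x y + d y z)
        ≤⟨ pointwise-≡⇒≤ (D * (d x y + d y z)) (D * d x y + D * d y z)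
             (λ n → ℚₚ.*-distribˡ-+ (seq D n) (seq (d x y) n) (seq (d y z) n)) ⟩
      D * d x y + D * d y z ∎

    -- Skipping the stop at `x₀` replaces two moves by one, which is no dearer by the triangle
    -- inequality, and saves the service cost `w` of the prepended request.
    cost-tail≤cost-∷ : ∀ {n} p (s : Vector Carrier n) → cost (tail p) s ≤ cost p (p₀ ∷ s)
    cost-tail≤cost-∷ {ℕ.zero} p s =
      -- The left side is a sum of zeros, accepted as `0ℝ` because `_≤_` inspects only the sequences
      -- and `0ℚ ℚ.+ 0ℚ` computes.
      +-mono-≤ 0ℝ (D * d p₀ (p zero) + d (p zero) p₀) 0ℝ 0ℝ
        (+-mono-≤ 0ℝ (D * d p₀ (p zero)) 0ℝ (d (p zero) p₀) (0≤D*d p₀ (p zero)) nonNegative)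
        (≤-refl 0ℝ)
    cost-tail≤cost-∷ {ℕ.suc n} p s = begin
      D * d p₀ x₁ + b + r
        ≤⟨ +-mono-≤ (D * d p₀ x₁ + b) (u + v + b) r r
             (+-mono-≤ (D * d p₀ x₁) (u + v) b b (D*d-triangle p₀ x₀ x₁) (≤-refl b))
             (≤-refl r) ⟩
      u + v + b + r
        -- The added zero is a placeholder, raised to `w` in the next step.
        ≤⟨ pointwise-≡⇒≤ (u + v + b + r) (u + v + b + r + 0ℝ)
             (λ n → sym (ℚₚ.+-identityʳ (seq (u + v + b + r) n))) ⟩
      u + v + b + r + 0ℝ
        ≤⟨ +-mono-≤ (u + v + b + r) (u + v + b + r) 0ℝ w (≤-refl (u + v + b + r)) nonNegative ⟩
      u + v + b + r + w
        ≤⟨ pointwise-≡⇒≤ (u + v + b + r + w) (u + w + (v + b + r))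
             (λ n → first-step-regroup (seq u n) (seq w n) (seq v n) (seq b n) (seq r n)) ⟩
      u + w + (v + b + r) ∎
      where
      x₀ x₁ : Carrier
      x₀ = p zero
      x₁ = p (suc zero)
      u v w b r : ℝ
      u = D * d p₀ x₀
      v = D * d x₀ x₁
      w = d x₀ p₀
      b = d x₁ (s zero)
      r = ∑ λ t → D * d (p (suc (inject₁ t))) (p (suc (suc t))) + d (p (suc (suc t))) (s (suc t))

    -- Serving `p₀` while staying there is free, and the next move still starts at `p₀`.
    cost-∷-∷≤cost : ∀ {n} (p s : Vector Carrier n) → cost (p₀ ∷ p) (p₀ ∷ s) ≤ cost p s
    cost-∷-∷≤cost p s = begin
      D * d p₀ p₀ + d p₀ p₀ + cost p s
        ≤⟨ +-mono-≤ (D * d p₀ p₀ + d p₀ p₀) (D * 0ℝ + 0ℝ) (cost p s) (cost p s)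
             (+-mono-≤ (D * d p₀ p₀) (D * 0ℝ) (d p₀ p₀) 0ℝ
               (*-monoˡ-≤-pos D (d p₀ p₀) 0ℝ 0<D d≤0) d≤0)
             (≤-refl (cost p s)) ⟩
      D * 0ℝ + 0ℝ + cost p s
        ≤⟨ pointwise-≡⇒≤ (D * 0ℝ + 0ℝ + cost p s) (cost p s)
             (λ n → p*0+0+q≡q (seq D n) (seq (cost p s) n)) ⟩
      cost p s ∎
      where
      d≤0 : d p₀ p₀ ≤ 0ℝ
      d≤0 = ≈⇒≤ {d p₀ p₀} {0ℝ} (≈⇒0 EqC.refl)

    -- Each page sequence for either problem yields one for the other that costs no more, so both
    -- families of costs have the same lower bounds and hence the same infima.
    isOptimalCost-∷ : ∀ {n} (s : Vector Carrier n) opt →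
      IsOptimalCost s opt → IsOptimalCost (p₀ ∷ s) opt
    isOptimalCost-∷ s opt (lower , greatest) =
      (λ p → begin
        opt                ≤⟨ lower (tail p) ⟩
        cost (tail p) s    ≤⟨ cost-tail≤cost-∷ p s ⟩
        cost p (p₀ ∷ s)    ∎) ,
      (λ l l≤cost → greatest l λ p → begin
        l                       ≤⟨ l≤cost (p₀ ∷ p) ⟩
        cost (p₀ ∷ p) (p₀ ∷ s)  ≤⟨ cost-∷-∷≤cost p s ⟩
        cost p s                ∎)

    isOptimalCost-pad : ∀ k {n} (s : Vector Carrier n) opt →
      IsOptimalCost s opt → IsOptimalCost (pad k p₀ s) opt
    isOptimalCost-pad ℕ.zero    s opt isOpt = isOpt
    isOptimalCost-pad (ℕ.suc k) s opt isOpt =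
      isOptimalCost-∷ (pad k p₀ s) opt (isOptimalCost-pad k s opt isOpt)

    -- Here `p` is arbitrary because a prediction algorithm may leave `p₀` during the padding.
    cost-drop≤cost-pad : ∀ k {n} p (s : Vector Carrier n) →
      cost (drop k p) s ≤ cost p (pad k p₀ s)
    cost-drop≤cost-pad ℕ.zero    p s = ≤-refl (cost p s)
    cost-drop≤cost-pad (ℕ.suc k) p s = begin
      cost (drop k (tail p)) s    ≤⟨ cost-drop≤cost-pad k (tail p) s ⟩
      cost (tail p) (pad k p₀ s)  ≤⟨ cost-tail≤cost-∷ p (pad k p₀ s) ⟩
      cost p (p₀ ∷ pad k p₀ s)    ∎

    errors⊆lastIndices : ∀ k {n} (s : Vector Carrier n) t →
      ¬ (pad k p₀ s t ≈ₓ p₀) → t ∈ lastIndices k n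
    errors⊆lastIndices ℕ.zero    s t       s≉p₀ = ∈⊤
    errors⊆lastIndices (ℕ.suc k) s zero    s≉p₀ = contradiction EqC.refl s≉p₀
    errors⊆lastIndices (ℕ.suc k) s (suc t) s≉p₀ = there (errors⊆lastIndices k s t s≉p₀)

    -- From prediction algorithms to online algorithms

    onPadded : ∀ k {n} → PredictionAlgorithm (k ℕ.+ n) → OnlineAlgorithm n
    onPadded k {n} A = record
      { run    = λ s → drop k (run ŝ (pad k p₀ s))
      -- The prediction is the same for `s` and `s′`, so it reveals nothing about future requests.
      ; online = λ s s′ t s≈s′ → online ŝ ŝ (pad k p₀ s) (pad k p₀ s′) (k ↑ʳ t)
                   (λ _ → EqC.refl) (pad-cong-≤ _≈ₓ_ k EqC.refl s s′ t s≈s′)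
      }
      where
      open PredictionAlgorithm A
      ŝ : Vector Carrier (k ℕ.+ n)
      ŝ = replicate (k ℕ.+ n) p₀

    onPadded-competitive : ∀ k {n} ρ A →
      CompetitiveOn (ErrorsAtMost n) ρ A → Competitive ρ (onPadded k {n} A)
    onPadded-competitive k {n} ρ A comp s opt isOpt = begin
      cost (drop k p) s     ≤⟨ cost-drop≤cost-pad k p s ⟩
      cost p (pad k p₀ s)   ≤⟨ comp ŝ (pad k p₀ s) errors opt (isOptimalCost-pad k s opt isOpt) ⟩
      ρ * opt               ∎
      where
      ŝ p : Vector Carrier (k ℕ.+ n)
      ŝ = replicate (k ℕ.+ n) p₀
      p = PredictionAlgorithm.run A ŝ (pad k p₀ s)
      errors : ErrorsAtMost n ŝ (pad k p₀ s)
      errors = lastIndices k n , ℕₚ.≤-reflexive (∣lastIndices∣≡n k n) , errors⊆lastIndices k s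

    -- With the length `n` a variable, matching on `refl` replaces it by `k ℕ.+ m`, so no algorithm
    -- has to be transported.
    online-of-prediction : ∀ k {m n} → k ℕ.+ m ≡ n → ∀ ρ →
      ∃[ A ] CompetitiveOn {n} (ErrorsAtMost m) ρ A → ∃[ B ] Competitive {m} ρ B
    online-of-prediction k refl ρ (A , comp) = onPadded k A , onPadded-competitive k ρ A comp

mainTheorem4 : ∀ {a ℓ} (X : MetricSpace a ℓ) (p₀ : MetricSpace.Carrier X) (D q : ℝ) →
    1ℝ < D → 0ℝ < q → q < 1ℝ →
    (n qn : ℕ) → 0 ℕ.< n → 0 ℕ.< qn → q * fromℕ n ≈ fromℕ qn →
    (c : ℝ) → 1ℝ ≤ c →
    let open PageMigration X D p₀ in
    (∀ c′ → c′ < c → ¬ (∃[ A ] Competitive {qn} c′ A)) →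
    ∀ c′ → c′ < c → ¬ (∃[ A ] CompetitiveOn {n} (ErrorsAtMost qn) c′ A)
mainTheorem4 X p₀ D q 1<D _ q<1 n qn _ _ q*n≈qn c _ hard c′ c′<c A-comp =
  -- Truncated subtraction gives the right padding length, since `q < 1` forces `qn` to be at most
  -- `n`.
  hard c′ c′<c (online-of-prediction X p₀ D (1<x⇒0<x D 1<D) (n ℕ.∸ qn)
    (ℕₚ.m∸n+n≡m (q*n≈m⇒m≤n X q n qn q<1 q*n≈qn)) c′ A-comp)
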